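{- Let $n$, $k$ and $\ell$ be integers with $k\geq \ell\geq 1$ and $n\geq \ell+2$. Let $G$ be an $n$-vertex graph such that there is a labelling $v_1,\ldots,v_n$ of $V(G)$ with the following two properties: (i) for every edge $v_iv_j\in E(G)$ we have $|i-j|\leq k$; (ii) for every $i\in[n]$, \[ \deg_G(v_i)\geq \min\{\,k+\ell,\ \min\{i-1,k\}+\min\{n-i,k\}\,\}. \] Then $G$ contains a spanning subdivision of $K_{2,\ell}$ rooted at $v_1$ and $v_n$, i.e.\ there exist $\ell$ paths in $G$, each from $v_1$ to $v_n$ and each with at least two edges, which pairwise share no vertices other than $v_1$ and $v_n$, and whose union covers all vertices of $G$.
   Context: Condition (i) says that the labelling is an embedding of $G$ into $P_n^k$, the $k$-th power of the path $v_1\cdots v_n$ (where $v_i,v_j$ are adjacent iff $1\le |i-j|\le k$), so $G$ has bandwidth at most $k$; the quantity $\min\{i-1,k\}+\min\{n-i,k\}$ is the degree of the $i$-th vertex of $P_n^k$. The paper abbreviates (i) and (ii) as $\delta^k_{\mathrm{eff}}(G)\ge k+\ell$ (effective minimum degree). A subdivision of a graph $H$ is obtained by replacing each edge of $H$ by a path of positive length, all such paths internally disjoint; a subdivision of $K_{2,\ell}$ rooted at $u,v$ is one in which the two vertices of the part of size $2$ of $K_{2,\ell}$ are $u$ and $v$. -}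

module Defs where

open import Level using (0ℓ)
open import Data.Nat using (ℕ; zero; suc; _+_; _∸_; _≤_; _<_; _⊓_)
open import Data.Nat.Properties using (n<1+n)
open import Data.Fin using (Fin; toℕ; fromℕ<)
open import Data.List using (List; []; _∷_; _++_; [_]; length; filter; allFin)
open import Data.List.Relation.Unary.Linked using (Linked)
open import Data.List.Relation.Unary.Unique.Propositional using (Unique)
open import Data.List.Membership.Propositional using (_∈_)
open import Data.Product using (Σ; ∃; _×_; _,_)
open import Data.Sum using (_⊎_)
open import Relation.Nullary using (¬_)
open import Relation.Unary using (Decidable)
open import Relation.Binary.PropositionalEquality using (_≡_)

-- A finite simple graph whose vertex set is labelled v₁,…,vₙ; vertex
-- i : Fin n stands for v_{toℕ i + 1}.
record Graph (n : ℕ) : Set₁ where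
  field
    Adj   : Fin n → Fin n → Set
    adj?  : ∀ i → Decidable (Adj i)
    sym   : ∀ {i j} → Adj i j → Adj j i
    irrefl : ∀ {i} → ¬ Adj i i

open Graph public

deg : ∀ {n} → Graph n → Fin n → ℕ
deg {n} G i = length (filter (adj? G i) (allFin n))

dist : ℕ → ℕ → ℕ
dist a b = (a ∸ b) + (b ∸ a)

BandwidthLabelling : ∀ {n} → Graph n → ℕ → Set
BandwidthLabelling G k = ∀ i j → Adj G i j → dist (toℕ i) (toℕ j) ≤ k

-- (ii) deg(v_i) ≥ min{k+ℓ, min{i-1,k} + min{n-i,k}}  (with 1-based i = toℕ i + 1)
DegreeCondition : ∀ {n} → Graph n → ℕ → ℕ → Set
DegreeCondition {n} G k ℓ =
  ∀ i → (k + ℓ) ⊓ ((toℕ i ⊓ k) + ((n ∸ suc (toℕ i)) ⊓ k)) ≤ deg G i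

vFirst : ∀ {n} → 0 < n → Fin n
vFirst p = fromℕ< p

vLast : ∀ {n} → 0 < n → Fin n
vLast {n} p = fromℕ< (n∸1<n n p)
  where
  n∸1<n : ∀ m → 0 < m → m ∸ 1 < m
  n∸1<n (suc m) _ = n<1+n m

IsPath : ∀ {n} → Graph n → Fin n → Fin n → List (Fin n) → Set
IsPath G a b int = Linked (Adj G) (a ∷ int ++ [ b ]) × Unique (a ∷ int ++ [ b ])

SpanningK2Subdivision : ∀ {n} → Graph n → (ℓ : ℕ) → Fin n → Fin n → Set
SpanningK2Subdivision {n} G ℓ a b =
  Σ (Fin ℓ → List (Fin n)) λ P →
      (∀ p → IsPath G a b (P p))
    × (∀ p → ¬ (P p ≡ []))
    × (∀ p q → ¬ (p ≡ q) → ∀ x → x ∈ P p → ¬ (x ∈ P q))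
    × (∀ x → x ≡ a ⊎ x ≡ b ⊎ ∃ λ p → x ∈ P p)

{-# OPTIONS --safe #-}

-- Greedy construction.  The ℓ paths leave v₁ through v₂,…,v_{ℓ+1}; always extend
-- the open path whose tip is lowest, moving to the smallest unvisited neighbour
-- other than vₙ, and join the tip to vₙ when there is no such neighbour.
--
-- While x is unvisited, a move from e to some y > x requires e ≁ x, since x would
-- have been preferred.  Charging each visited vertex of (x, x+k] to such a
-- departure e (or, when it is entered from beyond x+k, to the departure that
-- took the path there) bounds their number by the number of non-neighbours of x
-- already departed from.  As a non-neighbour count in the window of x is at most
-- k − ℓ, a tip x with x + k < n always has an unvisited neighbour, so a stuck
-- tip is adjacent to vₙ.  If an unvisited vertex were left at the end, the
-- highest one would be a non-neighbour of all ℓ final tips, again too many.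
module Submission where

open import Defs
open import Data.Bool using (Bool; true; false)
import Data.Bool.Properties as Bool
open import Data.Fin using (Fin; zero; suc; toℕ; fromℕ<; _≟_)
open import Data.Fin.Properties using (toℕ<n; toℕ-injective; toℕ-fromℕ<)
open import Data.List using (List; []; _∷_; _++_; [_]; length; filter; tabulate)
open import Data.List.Membership.Propositional using (_∈_)
open import Data.List.Membership.Propositional.Properties using (∈-++⁻; ∈-++⁺ˡ; ∈-++⁺ʳ)
open import Data.List.Relation.Unary.All as All using ()
open import Data.List.Relation.Unary.AllPairs using ([]; _∷_)
open import Data.List.Relation.Unary.Any using (here)
open import Data.List.Relation.Unary.Linked using (Linked; [-]; _∷_)
open import Data.List.Relation.Unary.Unique.Propositional using (Unique)
import Data.List.Relation.Unary.Unique.Propositional.Properties as Unique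
open import Data.Nat hiding (_≟_)
open import Data.Nat.Properties hiding (_≟_)
open import Algebra.Properties.CommutativeSemigroup +-commutativeSemigroup using (interchange; xy∙z≈xz∙y)
open import Data.Product using (∃; _×_; _,_; proj₁; proj₂)
open import Data.Sum using (_⊎_; inj₁; inj₂; [_,_]′)
open import Data.Vec.Functional using (updateAt)
open import Data.Vec.Functional.Properties using (updateAt-updates; updateAt-minimal)
open import Function using (_∘_; const; id; flip)
open import Level using (Level)
open import Relation.Binary.Definitions using (tri<; tri≈; tri>)
open import Relation.Binary.PropositionalEquality as ≡ hiding ([_]; sym)
open import Relation.Nullary using (¬_; Dec; yes; no; contradiction; ¬?; _×-dec_; _⊎-dec_)
open import Relation.Unary using (Decidable; _⊆_)

private variable
  a c : Level
  A : Set a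
  m : ℕ
  P Q R : Fin m → Set

-- Cardinalities of decidable subsets of `Fin m`

indicator : {X : Set} → Dec X → ℕ
indicator (yes _) = 1
indicator (no  _) = 0

indicator-mono : {X Y : Set} {X? : Dec X} {Y? : Dec Y} → (X → Y) → indicator X? ≤ indicator Y?
indicator-mono {X? = no  _}              f = z≤n
indicator-mono {X? = yes _} {Y? = yes _} f = ≤-refl
indicator-mono {X? = yes x} {Y? = no ¬y} f = contradiction (f x) ¬y

indicator≤1 : {X : Set} (X? : Dec X) → indicator X? ≤ 1
indicator≤1 (yes _) = ≤-refl
indicator≤1 (no  _) = z≤n

count : {P : Fin m → Set} → Decidable P → ℕ
count {zero}  P? = 0
count {suc m} P? = indicator (P? zero) + count (P? ∘ suc)

count-mono : (P? : Decidable P) (Q? : Decidable Q) → P ⊆ Q → count P? ≤ count Q?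
count-mono {zero}  P? Q? P⊆Q = z≤n
count-mono {suc m} P? Q? P⊆Q = +-mono-≤ (indicator-mono P⊆Q) (count-mono (P? ∘ suc) (Q? ∘ suc) P⊆Q)

count-cong : (P? : Decidable P) (Q? : Decidable Q) → P ⊆ Q → Q ⊆ P → count P? ≡ count Q?
count-cong P? Q? P⊆Q Q⊆P = ≤-antisym (count-mono P? Q? P⊆Q) (count-mono Q? P? Q⊆P)

count-mono-< : (P? : Decidable P) (Q? : Decidable Q) →
               P ⊆ Q → ∀ i → Q i → ¬ P i → count P? < count Q?
count-mono-< P? Q? P⊆Q zero q ¬p with P? zero | Q? zero
... | yes p | _     = contradiction p ¬p
... | no _  | no ¬q = contradiction q ¬q
... | no _  | yes _ = s≤s (count-mono (P? ∘ suc) (Q? ∘ suc) P⊆Q)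
count-mono-< P? Q? P⊆Q (suc i) q ¬p =
  +-mono-≤-< (indicator-mono P⊆Q) (count-mono-< (P? ∘ suc) (Q? ∘ suc) P⊆Q i q ¬p)

-- Serves wherever one element is exempt: the vertex or path altered by a greedy move, or vₙ in the
-- final count.
count-mono-except : (P? : Decidable P) (Q? : Decidable Q) →
                    ∀ i → (∀ j → j ≢ i → P j → Q j) → count P? ≤ suc (count Q?)
count-mono-except P? Q? zero f =
  ≤-trans (+-mono-≤ (indicator≤1 (P? zero)) (count-mono (P? ∘ suc) (Q? ∘ suc) (f _ λ ())))
          (s≤s (m≤n+m _ (indicator (Q? zero))))
count-mono-except P? Q? (suc i) f =
  ≤-trans (+-mono-≤ (indicator-mono (f zero λ ()))
                    (count-mono-except (P? ∘ suc) (Q? ∘ suc) i λ j j≢i → f (suc j) λ { refl → j≢i refl }))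
          (≤-reflexive (+-suc (indicator (Q? zero)) _))

count-empty : (P? : Decidable P) → (∀ i → ¬ P i) → count P? ≡ 0
count-empty {zero}  P? ¬P = refl
count-empty {suc m} P? ¬P with P? zero
... | yes p = contradiction p (¬P zero)
... | no  _ = count-empty (P? ∘ suc) (¬P ∘ suc)

count-full : (P? : Decidable P) → (∀ i → P i) → count {m} P? ≡ m
count-full {zero}  P? all = refl
count-full {suc m} P? all with P? zero
... | yes _ = cong suc (count-full (P? ∘ suc) (all ∘ suc))
... | no ¬p = contradiction (all zero) ¬p

count-≤-size : (P? : Decidable P) → count {m} P? ≤ m
count-≤-size {zero}  P? = z≤n
count-≤-size {suc m} P? = +-mono-≤ (indicator≤1 (P? zero)) (count-≤-size (P? ∘ suc))

count-<-size : (P? : Decidable P) → ∀ i → ¬ P i → count {m} P? < m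
count-<-size P? zero ¬p with P? zero
... | yes p = contradiction p ¬p
... | no  _ = s≤s (count-≤-size (P? ∘ suc))
count-<-size P? (suc i) ¬p =
  +-mono-≤-< (indicator≤1 (P? zero)) (count-<-size (P? ∘ suc) i ¬p)

count-cover : (P? : Decidable P) (Q? : Decidable Q) (R? : Decidable R) →
              (∀ i → R i → P i ⊎ Q i) → count R? ≤ count P? + count Q?
count-cover {zero}  P? Q? R? f = z≤n
count-cover {suc m} P? Q? R? f =
  ≤-trans (+-mono-≤ head (count-cover (P? ∘ suc) (Q? ∘ suc) (R? ∘ suc) (f ∘ suc)))
          (≤-reflexive (interchange (indicator (P? zero)) (indicator (Q? zero)) _ _))
  where
  head : indicator (R? zero) ≤ indicator (P? zero) + indicator (Q? zero)
  head with R? zero | P? zero | Q? zero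
  ... | no _  | _     | _     = z≤n
  ... | yes _ | yes _ | _     = s≤s z≤n
  ... | yes _ | no _  | yes _ = ≤-refl
  ... | yes r | no ¬p | no ¬q with f zero r
  ... | inj₁ p = contradiction p ¬p
  ... | inj₂ q = contradiction q ¬q

count-disjoint : (P? : Decidable P) (Q? : Decidable Q) (R? : Decidable R) →
                 P ⊆ R → Q ⊆ R → (∀ i → P i → ¬ Q i) → count P? + count Q? ≤ count R?
count-disjoint {zero}  P? Q? R? P⊆R Q⊆R P#Q = z≤n
count-disjoint {suc m} P? Q? R? P⊆R Q⊆R P#Q =
  ≤-trans (≤-reflexive (interchange (indicator (P? zero)) _ (indicator (Q? zero)) _))
          (+-mono-≤ head (count-disjoint (P? ∘ suc) (Q? ∘ suc) (R? ∘ suc) P⊆R Q⊆R (P#Q ∘ suc)))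
  where
  head : indicator (P? zero) + indicator (Q? zero) ≤ indicator (R? zero)
  head with P? zero | Q? zero | R? zero
  ... | no _  | no _  | _     = z≤n
  ... | yes _ | no _  | yes _ = ≤-refl
  ... | no _  | yes _ | yes _ = ≤-refl
  ... | yes p | yes q | _     = contradiction q (P#Q zero p)
  ... | yes p | no _  | no ¬r = contradiction (P⊆R p) ¬r
  ... | no _  | yes q | no ¬r = contradiction (Q⊆R q) ¬r

-- Intervals, pointwise updates, minimisers and lists

Between : ℕ → ℕ → Fin m → Set
Between lo hi i = lo ≤ toℕ i × toℕ i < hi

between? : ∀ lo hi → Decidable (Between {m} lo hi)
between? lo hi i = lo ≤? toℕ i ×-dec toℕ i <? hi

-- Induction on `m` strips `zero` and shifts both ends; the minimum with `m` accounts for an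
-- interval running past the last index.
count-between : ∀ m lo hi → count {m} (between? lo hi) ≡ (hi ⊓ m) ∸ lo
count-between zero    lo hi rewrite ⊓-zeroʳ hi = ≡.sym (0∸n≡0 lo)
count-between (suc m) lo zero = trans (count-empty (between? {suc m} lo 0) λ { _ (_ , ()) }) (≡.sym (0∸n≡0 lo))
count-between (suc m) zero (suc hi) = cong suc (trans
  (count-cong (between? {suc m} 0 (suc hi) ∘ suc) (between? {m} 0 hi)
    (λ (_ , i<hi) → z≤n , s≤s⁻¹ i<hi) (λ (_ , i<hi) → z≤n , s≤s i<hi))
  (count-between m 0 hi))
count-between (suc m) (suc lo) (suc hi) = trans
  (count-cong (between? {suc m} (suc lo) (suc hi) ∘ suc) (between? {m} lo hi)
    (λ (lo≤i , i<hi) → s≤s⁻¹ lo≤i , s≤s⁻¹ i<hi) (λ (lo≤i , i<hi) → s≤s lo≤i , s≤s i<hi))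
  (count-between m lo hi)

length-filter-tabulate : {P : A → Set} (P? : Decidable P) (f : Fin m → A) →
                         length (filter P? (tabulate f)) ≡ count (P? ∘ f)
length-filter-tabulate {m = zero}  P? f = refl
length-filter-tabulate {m = suc m} P? f with P? (f zero)
... | yes _ = cong suc (length-filter-tabulate P? (f ∘ suc))
... | no  _ = length-filter-tabulate P? (f ∘ suc)

-- The motive may mention the index, so hypotheses about `i` travel into both cases. The effect of a
-- move on statuses and paths is analysed through this.
updateAt-elim : (C : Fin m → A → Set c) (f : Fin m → A) (j : Fin m) {x : A} →
                C j x → (∀ i → i ≢ j → C i (f i)) → ∀ i → C i (updateAt f j (const x) i)
updateAt-elim C f j cj ci i with i ≟ j
... | yes refl = subst (C i) (≡.sym (updateAt-updates i f)) cj
... | no  i≢j  = subst (C i) (≡.sym (updateAt-minimal i j f i≢j)) (ci i i≢j)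

-- Makes both greedy choices: the open path with the lowest tip and the smallest admissible
-- neighbour.
argmin : (P? : Decidable P) (f : Fin m → ℕ) →
         (∀ i → ¬ P i) ⊎ ∃ λ i → P i × (∀ j → P j → f i ≤ f j)
argmin {zero} P? f = inj₁ λ ()
argmin {suc m} P? f with P? zero | argmin (P? ∘ suc) (f ∘ suc)
... | no ¬p | inj₁ ¬P = inj₁ λ { zero → ¬p ; (suc i) → ¬P i }
... | yes p | inj₁ ¬P = inj₂ (zero , p , λ { zero _ → ≤-refl ; (suc j) q → contradiction q (¬P j) })
... | no ¬p | inj₂ (i , q , min) =
  inj₂ (suc i , q , λ { zero p → contradiction p ¬p ; (suc j) r → min j r })
... | yes p | inj₂ (i , q , min) with ≤-total (f zero) (f (suc i))
... | inj₁ f0≤fi = inj₂ (zero , p , λ { zero _ → ≤-refl ; (suc j) r → ≤-trans f0≤fi (min j r) })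
... | inj₂ fi≤f0 = inj₂ (suc i , q , λ { zero _ → fi≤f0 ; (suc j) r → min j r })

linked-snoc : ∀ {A : Set} {R : A → A → Set} xs {x y} →
              Linked R (xs ++ [ x ]) → R x y → Linked R ((xs ++ [ x ]) ++ [ y ])
linked-snoc []           [-]        xy = xy ∷ [-]
linked-snoc (_ ∷ [])     (r ∷ [-])  xy = r ∷ xy ∷ [-]
linked-snoc (_ ∷ z ∷ xs) (r ∷ link) xy = r ∷ linked-snoc (z ∷ xs) link xy

-- Vertex statuses and partial paths

-- A live vertex is the tip of an open path; a spent one has been departed from.
data Status : Set where
  fresh live spent : Status

fresh? : Decidable (_≡ fresh)
fresh? fresh = yes refl
fresh? live  = no λ ()
fresh? spent = no λ ()

spent? : Decidable (_≡ spent)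
spent? fresh = no λ ()
spent? live  = no λ ()
spent? spent = yes refl

-- The inner vertices of a path, without v₁ and vₙ. A separate tip makes `nodes` nonempty, hence
-- every final path has at least two edges; `closed` records that vₙ follows the tip.
record Route (n : ℕ) : Set where
  constructor route
  field
    body   : List (Fin n)
    tip    : Fin n
    closed : Bool

  nodes : List (Fin n)
  nodes = body ++ [ tip ]

  tip∈nodes : tip ∈ nodes
  tip∈nodes = ∈-++⁺ʳ body (here refl)

open Route

-- Windows in the k-th power of the path, and degree deficits

module Greedy
  {n : ℕ} (G : Graph n) (k ℓ : ℕ) (ℓ≤k : ℓ ≤ k) (1≤ℓ : 1 ≤ ℓ)
  (bandwidth : BandwidthLabelling G k) (degrees : DegreeCondition G k ℓ)
  (a b : Fin n) (a-first : toℕ a ≡ 0) (b-last : suc (toℕ b) ≡ n)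
  where

  -- `Window x` is the neighbourhood of `x` in the k-th power of the path, split by side; truncated
  -- subtraction and the bound of `Fin n` cut it off at the two ends.
  Below Above Window : Fin n → Fin n → Set
  Below  x = Between (toℕ x ∸ k) (toℕ x)
  Above  x = Between (suc (toℕ x)) (suc (toℕ x + k))
  Window x v = Below x v ⊎ Above x v

  below? : ∀ x → Decidable (Below x)
  below? x = between? (toℕ x ∸ k) (toℕ x)

  above? : ∀ x → Decidable (Above x)
  above? x = between? (suc (toℕ x)) (suc (toℕ x + k))

  window? : ∀ x → Decidable (Window x)
  window? x v = below? x v ⊎-dec above? x v

  room : Fin n → ℕ
  room x = (n ∸ suc (toℕ x)) ⊓ k

  count-above : ∀ x → count (above? x) ≡ room x
  count-above x = begin
    count (above? x)                            ≡⟨ count-between n (suc i) (suc (i + k)) ⟩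
    (suc (i + k) ⊓ n) ∸ suc i                   ≡⟨ ∸-distribʳ-⊓ (suc i) (suc (i + k)) n ⟩
    (i + k ∸ i) ⊓ (n ∸ suc i)                   ≡⟨ cong (_⊓ (n ∸ suc i)) (m+n∸m≡n i k) ⟩
    k ⊓ (n ∸ suc i)                             ≡⟨ ⊓-comm k (n ∸ suc i) ⟩
    (n ∸ suc i) ⊓ k                             ∎
    where
    open ≡-Reasoning
    i = toℕ x

  count-below : ∀ x → count (below? x) ≤ toℕ x ⊓ k
  count-below x = begin
    count (below? x)      ≡⟨ count-between n (i ∸ k) i ⟩
    (i ⊓ n) ∸ (i ∸ k)     ≤⟨ ∸-monoˡ-≤ (i ∸ k) (m⊓n≤m i n) ⟩
    i ∸ (i ∸ k)           ≤⟨ ⊓-glb (m∸n≤m i (i ∸ k))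
                               (m≤n+o⇒m∸n≤o i (i ∸ k) (≤-trans (m≤n+m∸n i k) (≤-reflexive (+-comm k (i ∸ k))))) ⟩
    i ⊓ k                 ∎
    where
    open ≤-Reasoning
    i = toℕ x

  count-window : ∀ x → count (window? x) ≤ (toℕ x ⊓ k) + room x
  count-window x = ≤-trans (count-cover (below? x) (above? x) (window? x) λ _ → id)
                           (+-mono-≤ (count-below x) (≤-reflexive (count-above x)))

  deg-count : ∀ x → deg G x ≡ count (adj? G x)
  deg-count x = length-filter-tabulate (adj? G x) id

  adj⇒window : ∀ {x v} → Adj G x v → Window x v
  adj⇒window {x} {v} xv with <-cmp (toℕ x) (toℕ v)
  ... | tri< x<v _ _ = inj₂ (x<v , s≤s (≤-trans (m≤n+m∸n (toℕ v) (toℕ x))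
          (+-monoʳ-≤ (toℕ x) (≤-trans (m≤n+m _ (toℕ x ∸ toℕ v)) (bandwidth x v xv)))))
  ... | tri≈ _ x≡v _ = contradiction (subst (Adj G x) (≡.sym (toℕ-injective x≡v)) xv) (irrefl G)
  ... | tri> _ _ v<x = inj₁ (m≤n+o⇒m∸n≤o (toℕ x) k (≤-trans (m≤n+m∸n (toℕ x) (toℕ v))
          (≤-trans (+-monoʳ-≤ (toℕ v) (≤-trans (m≤m+n _ _) (bandwidth x v xv)))
                   (≤-reflexive (+-comm (toℕ v) k)))) , v<x)

  -- Neighbours and `R` are disjoint inside a window of at most `(toℕ x ⊓ k) + room x` vertices. If
  -- the required degree is `k + ℓ`, bounding the part below `x` by `k` and cancelling gives the
  -- second alternative; if it is that whole window bound, nothing remains for `R`.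
  slack : ∀ x {R : Fin n → Set} (R? : Decidable R) → R ⊆ Window x → (∀ v → R v → ¬ Adj G x v) →
          count R? ≡ 0 ⊎ ℓ + count R? ≤ room x
  slack x R? R⊆W R#N with ⊓-sel (k + ℓ) ((toℕ x ⊓ k) + room x)
  ... | inj₁ eq = inj₂ (+-cancelˡ-≤ k _ _ (begin
    k + (ℓ + count R?)             ≡⟨ +-assoc k ℓ _ ⟨
    k + ℓ + count R?               ≡⟨ cong (_+ count R?) eq ⟨
    _ + count R?                   ≤⟨ +-monoˡ-≤ (count R?) (degrees x) ⟩
    deg G x + count R?             ≡⟨ cong (_+ count R?) (deg-count x) ⟩
    count (adj? G x) + count R?    ≤⟨ count-disjoint (adj? G x) R? (window? x) adj⇒window R⊆W (λ v → flip (R#N v)) ⟩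
    count (window? x)              ≤⟨ count-window x ⟩
    (toℕ x ⊓ k) + room x           ≤⟨ +-monoˡ-≤ (room x) (m⊓n≤n (toℕ x) k) ⟩
    k + room x                     ∎))
    where open ≤-Reasoning
  ... | inj₂ eq = inj₁ (n≤0⇒n≡0 (+-cancelˡ-≤ (deg G x) _ _ (begin
    deg G x + count R?             ≡⟨ cong (_+ count R?) (deg-count x) ⟩
    count (adj? G x) + count R?    ≤⟨ count-disjoint (adj? G x) R? (window? x) adj⇒window R⊆W (λ v → flip (R#N v)) ⟩
    count (window? x)              ≤⟨ count-window x ⟩
    (toℕ x ⊓ k) + room x           ≡⟨ eq ⟨
    _                              ≤⟨ degrees x ⟩
    deg G x                        ≡⟨ +-identityʳ (deg G x) ⟨
    deg G x + 0                    ∎)))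
    where open ≤-Reasoning

  -- With a window bound of at most `k`, the minimum in the degree condition is that bound, so a
  -- single non-neighbour in the window would violate it. Applied to v₁ and vₙ, whose windows are
  -- one-sided.
  full : ∀ {x v} → (toℕ x ⊓ k) + room x ≤ k → Window x v → Adj G x v
  full {x} {v} small xv with adj? G x v
  ... | yes adj = adj
  ... | no ¬adj = contradiction (begin-strict
    deg G x                           ≡⟨ deg-count x ⟩
    count (adj? G x)                  <⟨ count-mono-< (adj? G x) (window? x) adj⇒window v xv ¬adj ⟩
    count (window? x)                 ≤⟨ count-window x ⟩
    (toℕ x ⊓ k) + room x              ≡⟨ m≥n⇒m⊓n≡n (≤-trans small (m≤m+n k ℓ)) ⟨
    (k + ℓ) ⊓ ((toℕ x ⊓ k) + room x)  ≤⟨ degrees x ⟩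
    deg G x                           ∎) (<-irrefl refl)
    where open ≤-Reasoning

  -- Counters and invariants of the greedy process

  Seen : (Fin n → Status) → Fin n → Fin n → Set
  Seen st x v = st v ≢ fresh × Above x v

  seen? : ∀ st x → Decidable (Seen st x)
  seen? st x v = ¬? (fresh? (st v)) ×-dec above? x v

  -- The paying side of the charging: departed non-neighbours of `x`, whose number `slack` limits.
  -- The tip of a closed path counts as departed.
  Missed : (Fin n → Status) → Fin n → Fin n → Set
  Missed st x v = st v ≡ spent × Window x v × ¬ Adj G x v

  missed? : ∀ st x → Decidable (Missed st x)
  missed? st x v = spent? (st v) ×-dec window? x v ×-dec ¬? (adj? G x v)

  -- A closed path is `Out` for every `x`, so `#out` ends at `ℓ`. When `x` is a tip, the `Low` paths
  -- are those that may still move before it gets its turn.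
  Out Low : Fin n → Route n → Set
  Out x ρ = closed ρ ≡ true ⊎ toℕ x + k < toℕ (tip ρ)
  Low x ρ = closed ρ ≡ false × toℕ (tip ρ) < toℕ x

  out? : ∀ x → Decidable (Out x)
  out? x ρ = closed ρ Bool.≟ true ⊎-dec toℕ x + k <? toℕ (tip ρ)

  low? : ∀ x → Decidable (Low x)
  low? x ρ = closed ρ Bool.≟ false ×-dec toℕ (tip ρ) <? toℕ x

  #seen #missed : (Fin n → Status) → Fin n → ℕ
  #seen   st x = count (seen? st x)
  #missed st x = count (missed? st x)

  #out #low : (Fin ℓ → Route n) → Fin n → ℕ
  #out r x = count (out? x ∘ r)
  #low r x = count (low? x ∘ r)

  record State : Set where
    field
      status : Fin n → Status
      routes : Fin ℓ → Route n
      root-seen : status a ≢ fresh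
      linked    : ∀ p → Linked (Adj G) (a ∷ nodes (routes p))
      unique    : ∀ p → Unique (nodes (routes p))
      inner     : ∀ p {x} → x ∈ nodes (routes p) → 0 < toℕ x × suc (toℕ x) < n
      visited   : ∀ p {x} → x ∈ nodes (routes p) → status x ≢ fresh
      disjoint  : ∀ p q {x} → x ∈ nodes (routes p) → x ∈ nodes (routes q) → p ≡ q
      covered   : ∀ x → status x ≢ fresh → x ≡ a ⊎ ∃ λ p → x ∈ nodes (routes p)
      tip-live  : ∀ p → closed (routes p) ≡ false → status (tip (routes p)) ≡ live
      tip-last  : ∀ p → closed (routes p) ≡ true → Adj G (tip (routes p)) b
      -- A path beyond x + k counts on the left, as it may come back into
      -- (x, x+k] without leaving behind a non-neighbour of x.
      fresh-bound : ∀ x → suc (toℕ x) < n → status x ≡ fresh →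
                    #seen status x + #out routes x ≤ #missed status x
      -- Each of the open paths lying below the tip x can still jump over x
      -- once before x, being lowest, gets its turn.
      tip-bound   : ∀ p → closed (routes p) ≡ false →
                    let x = tip (routes p) in
                    suc (#seen status x + #low routes x) ≤ #missed status x + ℓ

    -- Termination measure: extending lowers the number of unvisited vertices, closing lowers the
    -- number of open paths, and neither raises the other summand.
    size : ℕ
    size = count (fresh? ∘ status) + count (λ p → closed (routes p) Bool.≟ false)

  open State

  -- The clause `suc (toℕ y) < n` keeps vₙ out; v₁ is kept out by never being fresh.
  Next : State → Fin ℓ → Fin n → Set
  Next s q y = status s y ≡ fresh × suc (toℕ y) < n × Adj G (tip (routes s q)) y

  next? : ∀ s q → Decidable (Next s q)
  next? s q y = fresh? (status s y) ×-dec suc (toℕ y) <? n ×-dec adj? G (tip (routes s q)) y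

  Lowest : State → Fin ℓ → Set
  Lowest s q = closed (routes s q) ≡ false ×
               (∀ p → closed (routes s p) ≡ false → toℕ (tip (routes s q)) ≤ toℕ (tip (routes s p)))

  tip-distinct : ∀ s {p q} → p ≢ q → tip (routes s p) ≢ tip (routes s q)
  tip-distinct s {p} {q} p≢q eq =
    p≢q (disjoint s p q (tip∈nodes (routes s p))
                        (subst (_∈ nodes (routes s q)) (≡.sym eq) (tip∈nodes (routes s q))))

  -- Ties cannot occur, because disjoint paths have distinct tips.
  above-lowest : ∀ s {p q} → Lowest s q → p ≢ q → closed (routes s p) ≡ false →
                 toℕ (tip (routes s q)) < toℕ (tip (routes s p))
  above-lowest s (_ , low) p≢q open-p =
    ≤∧≢⇒< (low _ open-p) (tip-distinct s (p≢q ∘ ≡.sym) ∘ toℕ-injective)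

  -- Preservation of the invariants when the lowest path is extended

  module Extend (s : State) (q : Fin ℓ) (lowest : Lowest s q)
                (y : Fin n) (next : Next s q y) (least : ∀ z → Next s q z → toℕ y ≤ toℕ z) where
    e : Fin n
    e = tip (routes s q)

    y-fresh : status s y ≡ fresh
    y-fresh = proj₁ next

    e~y : Adj G e y
    e~y = proj₂ (proj₂ next)

    e-live : status s e ≡ live
    e-live = tip-live s q (proj₁ lowest)

    st : Fin n → Status
    st = updateAt (updateAt (status s) e (const spent)) y (const live)

    r : Fin ℓ → Route n
    r = updateAt (routes s) q (const (route (nodes (routes s q)) y false))

    st-elim : (C : Fin n → Status → Set) → C y live → C e spent →
              (∀ v → v ≢ e → v ≢ y → C v (status s v)) → ∀ v → C v (st v)
    st-elim C cy ce cv = updateAt-elim C _ y cy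
      -- The inner motive carries `v ≢ y`, so that the last case receives both inequalities.
      (updateAt-elim (λ v σ → v ≢ y → C v σ) (status s) e (λ _ → ce) cv)

    r-elim : (C : Fin ℓ → Route n → Set) → C q (route (nodes (routes s q)) y false) →
             (∀ p → p ≢ q → C p (routes s p)) → ∀ p → C p (r p)
    r-elim C = updateAt-elim C (routes s) q

    fresh≢live : ∀ {v} → status s v ≡ fresh → status s v ≢ live
    fresh≢live eq eq′ with trans (≡.sym eq) eq′
    ... | ()

    y≢e : y ≢ e
    y≢e refl = fresh≢live y-fresh e-live

    visited-mono : ∀ v → status s v ≢ fresh → st v ≢ fresh
    visited-mono = st-elim (λ v σ → status s v ≢ fresh → σ ≢ fresh) (λ _ ()) (λ _ ()) (λ _ _ _ → id)

    visited⁻ : ∀ v → v ≢ y → st v ≢ fresh → status s v ≢ fresh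
    visited⁻ = st-elim (λ v σ → v ≢ y → σ ≢ fresh → status s v ≢ fresh)
      (λ y≢y → contradiction refl y≢y)
      (λ _ _ eq → fresh≢live eq e-live) (λ _ _ _ _ → id)

    fresh⁻ : ∀ v → st v ≡ fresh → status s v ≡ fresh × v ≢ y
    fresh⁻ = st-elim (λ v σ → σ ≡ fresh → status s v ≡ fresh × v ≢ y) (λ ()) (λ ()) (λ _ _ v≢y eq → eq , v≢y)

    spent-mono : ∀ v → status s v ≡ spent → st v ≡ spent
    spent-mono = st-elim (λ v σ → status s v ≡ spent → σ ≡ spent)
      (λ eq → contradiction (trans (≡.sym y-fresh) eq) λ ()) (λ _ → refl) (λ _ _ _ → id)

    e-spent : st e ≡ spent
    e-spent = st-elim (λ v σ → v ≡ e → σ ≡ spent)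
      (λ y≡e → contradiction y≡e y≢e) (λ _ → refl) (λ _ v≢e _ v≡e → contradiction v≡e v≢e) e refl

    live-keep : ∀ v → v ≢ e → status s v ≡ live → st v ≡ live
    live-keep = st-elim (λ v σ → v ≢ e → status s v ≡ live → σ ≡ live)
      (λ _ _ → refl) (λ e≢e → contradiction refl e≢e) (λ _ _ _ _ → id)

    ∈-snoc : ∀ {x} → x ∈ nodes (routes s q) ++ [ y ] → x ∈ nodes (routes s q) ⊎ x ≡ y
    ∈-snoc x∈ with ∈-++⁻ (nodes (routes s q)) x∈
    ... | inj₁ x∈q         = inj₁ x∈q
    ... | inj₂ (here x≡y)  = inj₂ x≡y

    y∉ : ∀ p {x} → x ∈ nodes (routes s p) → x ≢ y
    y∉ p x∈ refl = visited s p x∈ y-fresh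

    nodes-mono : ∀ p {x} → x ∈ nodes (routes s p) → x ∈ nodes (r p)
    nodes-mono p {x} = r-elim (λ p ρ → x ∈ nodes (routes s p) → x ∈ nodes ρ) ∈-++⁺ˡ (λ _ _ → id) p

    y∈ : y ∈ nodes (r q)
    y∈ = subst (λ ρ → y ∈ nodes ρ) (≡.sym (updateAt-updates q (routes s))) (∈-++⁺ʳ _ (here refl))

    disjoint′ : ∀ p p′ {x} → x ∈ nodes (r p) → x ∈ nodes (r p′) → p ≡ p′
    disjoint′ = r-elim (λ p ρ → ∀ p′ {x} → x ∈ nodes ρ → x ∈ nodes (r p′) → p ≡ p′)
      (λ p′ {x} → r-elim (λ p′ ρ → x ∈ nodes (routes s q) ++ [ y ] → x ∈ nodes ρ → q ≡ p′)
        (λ _ _ → refl)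
        (λ p′ _ x∈q x∈p′ → new p′ x∈q x∈p′) p′)
      (λ p _ p′ {x} → r-elim (λ p′ ρ → x ∈ nodes (routes s p) → x ∈ nodes ρ → p ≡ p′)
        (λ x∈p x∈q → ≡.sym (new p x∈q x∈p))
        (λ p′ _ → disjoint s p p′) p′)
      where
      new : ∀ p {x} → x ∈ nodes (routes s q) ++ [ y ] → x ∈ nodes (routes s p) → q ≡ p
      new p x∈q x∈p with ∈-snoc x∈q
      ... | inj₁ x∈ = disjoint s q p x∈ x∈p
      ... | inj₂ x≡y = contradiction x≡y (y∉ p x∈p)

    covered′ : ∀ x → st x ≢ fresh → x ≡ a ⊎ ∃ λ p → x ∈ nodes (r p)
    covered′ x x-seen with x ≟ y
    ... | yes refl = inj₂ (q , y∈)
    ... | no x≢y with covered s x (visited⁻ x x≢y x-seen)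
    ... | inj₁ x≡a = inj₁ x≡a
    ... | inj₂ (p , x∈) = inj₂ (p , nodes-mono p x∈)

    missed-mono : ∀ x → #missed (status s) x ≤ #missed st x
    missed-mono x = count-mono (missed? (status s) x) (missed? st x) (λ {v} (sp , rest) → spent-mono v sp , rest)

    -- `e` was live, hence uncounted before the move; becoming spent makes it a new payer for `x`.
    missed-gain : ∀ x → Window x e → ¬ Adj G x e → #missed (status s) x < #missed st x
    missed-gain x xe x≁e = count-mono-< (missed? (status s) x) (missed? st x)
      (λ {v} (sp , rest) → spent-mono v sp , rest) e (e-spent , xe , x≁e)
      (λ (sp , _) → contradiction (trans (≡.sym e-live) sp) λ ())

    seen-≤ : ∀ x → ¬ Above x y → #seen st x ≤ #seen (status s) x
    seen-≤ x ¬xy = count-mono (seen? st x) (seen? (status s) x)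
      λ {v} (v-seen , xv) → visited⁻ v (λ { refl → ¬xy xv }) v-seen , xv

    seen-≤1+ : ∀ x → #seen st x ≤ suc (#seen (status s) x)
    seen-≤1+ x = count-mono-except (seen? st x) (seen? (status s) x) y
      λ v v≢y (v-seen , xv) → visited⁻ v v≢y v-seen , xv

    out-⊆ : ∀ x → (toℕ x + k < toℕ y → toℕ x + k < toℕ e) → ∀ p → Out x (r p) → Out x (routes s p)
    out-⊆ x imp = r-elim (λ p ρ → Out x ρ → Out x (routes s p)) (λ { (inj₁ ()) ; (inj₂ far) → inj₂ (imp far) }) (λ _ _ → id)

    out-≤ : ∀ x → (toℕ x + k < toℕ y → toℕ x + k < toℕ e) → #out r x ≤ #out (routes s) x
    out-≤ x imp = count-mono (out? x ∘ r) (out? x ∘ routes s) (λ {p} → out-⊆ x imp p)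

    out-< : ∀ x → toℕ x + k < toℕ e → ¬ (toℕ x + k < toℕ y) → #out r x < #out (routes s) x
    out-< x e-far y-near = count-mono-< (out? x ∘ r) (out? x ∘ routes s)
      (λ {p} → out-⊆ x (λ y-far → contradiction y-far y-near) p) q (inj₂ e-far)
      (subst (λ ρ → ¬ Out x ρ) (≡.sym (updateAt-updates q (routes s))) λ { (inj₁ ()) ; (inj₂ y-far) → y-near y-far })

    out-≤1+ : ∀ x → #out r x ≤ suc (#out (routes s) x)
    out-≤1+ x = count-mono-except (out? x ∘ r) (out? x ∘ routes s) q
      (r-elim (λ p ρ → p ≢ q → Out x ρ → Out x (routes s p)) (λ q≢q → contradiction refl q≢q) (λ _ _ _ → id))

    -- If `y` is below `x`, nothing on the left grows. Landing in (x, x+k] may raise `#seen` by one;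
    -- landing farther may raise `#out` by one, but not if `e` was already beyond x+k. When `e` is
    -- not beyond x+k, it becomes missed and pays; when it is and `y` comes back, the drop in `#out`
    -- pays.
    fresh-bound′ : ∀ x → suc (toℕ x) < n → st x ≡ fresh → #seen st x + #out r x ≤ #missed st x
    fresh-bound′ x x<n x-fresh′ with fresh⁻ x x-fresh′
    ... | x-fresh , x≢y = bound (<-cmp (toℕ x) (toℕ y))
      where
      open ≤-Reasoning
      old : #seen (status s) x + #out (routes s) x ≤ #missed (status s) x
      old = fresh-bound s x x<n x-fresh

      -- `x` is unvisited and not vₙ, so adjacency to `e` would make it a candidate smaller than the
      -- chosen `y`.
      jumped : toℕ x < toℕ y → ¬ Adj G x e
      jumped x<y xe = <⇒≱ x<y (least x (x-fresh , x<n , Graph.sym G xe))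

      e≢x : toℕ e ≢ toℕ x
      e≢x eq = fresh≢live x-fresh (subst (λ v → status s v ≡ live) (toℕ-injective eq) e-live)

      y≤e+k : toℕ y ≤ toℕ e + k
      y≤e+k with adj⇒window e~y
      ... | inj₁ (_ , y<e) = ≤-trans (<⇒≤ y<e) (m≤m+n (toℕ e) k)
      ... | inj₂ (_ , y<)  = s≤s⁻¹ y<

      -- For `e` below `x`, the edge from `e` to `y` spans `x`, so `e` is within `k` of `x`.
      window : toℕ x < toℕ y → toℕ e ≤ toℕ x + k → Window x e
      window x<y e≤x+k with <-cmp (toℕ x) (toℕ e)
      ... | tri< x<e _ _ = inj₂ (x<e , s≤s e≤x+k)
      ... | tri≈ _ eq _  = contradiction (≡.sym eq) e≢x
      ... | tri> _ _ e<x = inj₁ (m≤n+o⇒m∸n≤o (toℕ x) k (≤-trans (<⇒≤ x<y)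
                             (≤-trans y≤e+k (≤-reflexive (+-comm (toℕ e) k)))) , e<x)

      gain : toℕ x < toℕ y → toℕ e ≤ toℕ x + k → #missed (status s) x < #missed st x
      gain x<y e≤ = missed-gain x (window x<y e≤) (jumped x<y)

      bound : _ → #seen st x + #out r x ≤ #missed st x
      bound (tri≈ _ eq _) = contradiction (toℕ-injective eq) x≢y
      bound (tri> _ _ y<x) = begin
        #seen st x + #out r x                       ≤⟨ +-mono-≤ (seen-≤ x λ (x<y , _) → <-asym x<y y<x)
                                                         (out-≤ x λ far → contradiction (≤-trans (m≤m+n (suc (toℕ x)) k) far) (<-asym y<x)) ⟩
        #seen (status s) x + #out (routes s) x      ≤⟨ old ⟩
        #missed (status s) x                        ≤⟨ missed-mono x ⟩
        #missed st x                                ∎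
      bound (tri< x<y _ _) with toℕ x + k <? toℕ y | toℕ x + k <? toℕ e
      ... | yes y-far | yes e-far = begin
        #seen st x + #out r x                       ≤⟨ +-mono-≤ (seen-≤ x λ (_ , y<) → <⇒≱ y< y-far)
                                                         (out-≤ x λ _ → e-far) ⟩
        #seen (status s) x + #out (routes s) x      ≤⟨ old ⟩
        #missed (status s) x                        ≤⟨ missed-mono x ⟩
        #missed st x                                ∎
      ... | yes y-far | no e-near = begin
        #seen st x + #out r x                       ≤⟨ +-mono-≤ (seen-≤ x λ (_ , y<) → <⇒≱ y< y-far) (out-≤1+ x) ⟩
        #seen (status s) x + suc (#out (routes s) x) ≡⟨ +-suc _ _ ⟩
        suc (#seen (status s) x + #out (routes s) x) ≤⟨ s≤s old ⟩
        suc (#missed (status s) x)                  ≤⟨ gain x<y (≮⇒≥ e-near) ⟩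
        #missed st x                                ∎
      ... | no y-near | yes e-far = begin
        #seen st x + #out r x                       ≤⟨ +-monoˡ-≤ _ (seen-≤1+ x) ⟩
        suc (#seen (status s) x) + #out r x         ≡⟨ +-suc _ _ ⟨
        #seen (status s) x + suc (#out r x)         ≤⟨ +-monoʳ-≤ _ (out-< x e-far y-near) ⟩
        #seen (status s) x + #out (routes s) x      ≤⟨ old ⟩
        #missed (status s) x                        ≤⟨ missed-mono x ⟩
        #missed st x                                ∎
      ... | no y-near | no e-near = begin
        #seen st x + #out r x                       ≤⟨ +-mono-≤ (seen-≤1+ x) (out-≤ x λ y-far → contradiction y-far y-near) ⟩
        suc (#seen (status s) x + #out (routes s) x) ≤⟨ s≤s old ⟩
        suc (#missed (status s) x)                  ≤⟨ gain x<y (≮⇒≥ e-near) ⟩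
        #missed st x                                ∎

    -- Path `q` is not below its own new tip; this supplies the `suc` in `tip-bound`.
    low-y : #low r y < ℓ
    low-y = count-<-size (low? y ∘ r) q
      (subst (λ ρ → ¬ Low y ρ) (≡.sym (updateAt-updates q (routes s))) λ (_ , y<y) → <-irrefl refl y<y)

    -- The new tip `y` was unvisited, so `fresh-bound` from before the move bounds its `#seen`. For
    -- the other open tips, the moved path pays out of `#low`.
    tip-bound′ : ∀ p → closed (r p) ≡ false →
                 suc (#seen st (tip (r p)) + #low r (tip (r p))) ≤ #missed st (tip (r p)) + ℓ
    tip-bound′ = r-elim (λ p ρ → closed ρ ≡ false → suc (#seen st (tip ρ) + #low r (tip ρ)) ≤ #missed st (tip ρ) + ℓ)
      (λ _ → at-y) other
      where
      open ≤-Reasoning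
      at-y : suc (#seen st y + #low r y) ≤ #missed st y + ℓ
      at-y = begin
        suc (#seen st y + #low r y)    ≡⟨ +-suc _ _ ⟨
        #seen st y + suc (#low r y)    ≤⟨ +-mono-≤ (seen-≤ y λ (y<y , _) → <-irrefl refl y<y) low-y ⟩
        #seen (status s) y + ℓ         ≤⟨ +-monoˡ-≤ ℓ (≤-trans (m≤m+n _ _) (fresh-bound s y (proj₁ (proj₂ next)) y-fresh)) ⟩
        #missed (status s) y + ℓ       ≤⟨ +-monoˡ-≤ ℓ (missed-mono y) ⟩
        #missed st y + ℓ               ∎

      other : ∀ p → p ≢ q → closed (routes s p) ≡ false → let x = tip (routes s p) in
              suc (#seen st x + #low r x) ≤ #missed st x + ℓ
      other p p≢q open-p = begin
        suc (#seen st x + #low r x)                       ≤⟨ s≤s split ⟩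
        suc (#seen (status s) x + #low (routes s) x)      ≤⟨ tip-bound s p open-p ⟩
        #missed (status s) x + ℓ                          ≤⟨ +-monoˡ-≤ ℓ (missed-mono x) ⟩
        #missed st x + ℓ                                  ∎
        where
        x = tip (routes s p)

        e<x : toℕ e < toℕ x
        e<x = above-lowest s lowest p≢q open-p

        low-⊆ : ∀ p → Low x (r p) → Low x (routes s p)
        low-⊆ = r-elim (λ p ρ → Low x ρ → Low x (routes s p)) (λ _ → proj₁ lowest , e<x) (λ _ _ → id)

        -- `e` lies below `x`, so `q` was low. Landing below `x` adds nothing to `#seen`; otherwise
        -- `q` ceases to be low, which offsets the one vertex possibly added.
        split : #seen st x + #low r x ≤ #seen (status s) x + #low (routes s) x
        split with toℕ y <? toℕ x
        ... | yes y<x = +-mono-≤ (seen-≤ x λ (x<y , _) → <-asym x<y y<x)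
                          (count-mono (low? x ∘ r) (low? x ∘ routes s) (λ {p} → low-⊆ p))
        ... | no y≮x = begin
          #seen st x + #low r x                       ≤⟨ +-monoˡ-≤ _ (seen-≤1+ x) ⟩
          suc (#seen (status s) x) + #low r x         ≡⟨ +-suc _ _ ⟨
          #seen (status s) x + suc (#low r x)         ≤⟨ +-monoʳ-≤ _ (count-mono-< (low? x ∘ r) (low? x ∘ routes s) (λ {p} → low-⊆ p) q
                                                            (proj₁ lowest , e<x)
                                                            (subst (λ ρ → ¬ Low x ρ) (≡.sym (updateAt-updates q (routes s))) λ (_ , y<x) → y≮x y<x)) ⟩
          #seen (status s) x + #low (routes s) x      ∎

    extend : State
    extend = record
      { status   = st
      ; routes   = r
      ; root-seen = visited-mono a (root-seen s)
      ; linked   = r-elim (λ _ ρ → Linked (Adj G) (a ∷ nodes ρ))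
                     (linked-snoc (a ∷ body (routes s q)) (linked s q) e~y) (λ p _ → linked s p)
      ; unique   = r-elim (λ _ ρ → Unique (nodes ρ))
                     (Unique.++⁺ (unique s q) (All.[] ∷ []) λ { (x∈q , here x≡y) → y∉ q x∈q x≡y })
                     (λ p _ → unique s p)
      ; inner    = r-elim (λ _ ρ → ∀ {x} → x ∈ nodes ρ → 0 < toℕ x × suc (toℕ x) < n)
                     (λ x∈ → [ inner s q , (λ { refl → 0<y , proj₁ (proj₂ next) }) ]′ (∈-snoc x∈))
                     (λ p _ → inner s p)
      ; visited  = r-elim (λ _ ρ → ∀ {x} → x ∈ nodes ρ → st x ≢ fresh)
                     (λ x∈ → [ (λ x∈q → visited-mono _ (visited s q x∈q)) , (λ { refl → y-seen }) ]′ (∈-snoc x∈))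
                     (λ p _ x∈ → visited-mono _ (visited s p x∈))
      ; disjoint = disjoint′
      ; covered  = covered′
      ; tip-live = r-elim (λ _ ρ → closed ρ ≡ false → st (tip ρ) ≡ live)
                     (λ _ → updateAt-updates y _)
                     (λ p p≢q open-p → live-keep _ (tip-distinct s p≢q) (tip-live s p open-p))
      ; tip-last = r-elim (λ _ ρ → closed ρ ≡ true → Adj G (tip ρ) b) (λ ()) (λ p _ → tip-last s p)
      ; fresh-bound = fresh-bound′
      ; tip-bound   = tip-bound′
      }
      where
      y-seen : st y ≢ fresh
      y-seen eq with trans (≡.sym (updateAt-updates y _)) eq
      ... | ()

      0<y : 0 < toℕ y
      0<y = n≢0⇒n>0 λ y≡0 → root-seen s (subst (λ v → status s v ≡ fresh)
              (toℕ-injective (trans y≡0 (≡.sym a-first))) y-fresh)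

  -- Closing a stuck path at vₙ

  module Close (s : State) (q : Fin ℓ) (lowest : Lowest s q) (stuck : ∀ y → ¬ Next s q y) where
    e : Fin n
    e = tip (routes s q)

    e-live : status s e ≡ live
    e-live = tip-live s q (proj₁ lowest)

    Ahead : Fin n → Set
    Ahead v = status s v ≡ fresh × Above e v

    ahead? : Decidable Ahead
    ahead? v = fresh? (status s v) ×-dec above? e v

    idle? : Decidable (λ v → Missed (status s) e v ⊎ Ahead v)
    idle? v = missed? (status s) e v ⊎-dec ahead? v

    -- If the whole window of e lay before the last vertex, its fresh part and
    -- the missed vertices would be more non-neighbours than e can have.
    near-end : n ≤ suc (toℕ e + k)
    near-end with n ≤? suc (toℕ e + k)
    ... | yes p = p
    ... | no  p = contradiction
      -- Both alternatives of `slack` give k + 1 ≤ k: with no idle vertex through ℓ ≤ k, otherwise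
      -- because ℓ plus the idle vertices would fit into `room e`.
      ([ (λ none → ≤-trans (subst (λ c → suc k ≤ c + ℓ) none k<idle+ℓ) ℓ≤k)
      , (λ some → ≤-trans k<idle+ℓ (≤-trans (≤-reflexive (+-comm _ ℓ)) (≤-trans some (m⊓n≤n _ k))))
      ]′ (slack e idle? [ proj₁ ∘ proj₂ , inj₂ ∘ proj₂ ]′ idle≁e))
      (<-irrefl refl)
      where
      open ≤-Reasoning
      e+k<n : suc (toℕ e + k) < n
      e+k<n = ≰⇒> p

      -- A vertex ahead is at most e + k, hence before vₙ here, so adjacency would make it an
      -- admissible move.
      idle≁e : ∀ v → Missed (status s) e v ⊎ Ahead v → ¬ Adj G e v
      idle≁e v (inj₁ (_ , _ , e≁v)) = e≁v
      idle≁e v (inj₂ (v-fresh , _ , v≤)) ev = stuck v (v-fresh , ≤-<-trans v≤ e+k<n , ev)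

      room-k : room e ≡ k
      room-k = m≥n⇒m⊓n≡n (m+n≤o⇒m≤o∸n k (≤-trans (≤-reflexive (+-comm k (suc (toℕ e)))) (<⇒≤ e+k<n)))

      -- `Above e` has all its `k` vertices here, each seen or ahead; `tip-bound` replaces the seen
      -- ones by missed ones plus ℓ - 1.
      k<idle+ℓ : suc k ≤ count idle? + ℓ
      k<idle+ℓ = begin
        suc k                                              ≡⟨ cong suc (trans (count-above e) room-k) ⟨
        suc (count (above? e))                             ≤⟨ s≤s (count-cover (seen? (status s) e) ahead? (above? e) split) ⟩
        suc (#seen (status s) e + count ahead?)            ≤⟨ +-monoˡ-≤ _ (s≤s (m≤m+n (#seen (status s) e) (#low (routes s) e))) ⟩
        suc (#seen (status s) e + #low (routes s) e) + count ahead?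
                                                           ≤⟨ +-monoˡ-≤ _ (tip-bound s q (proj₁ lowest)) ⟩
        #missed (status s) e + ℓ + count ahead?            ≡⟨ xy∙z≈xz∙y (#missed (status s) e) ℓ (count ahead?) ⟩
        #missed (status s) e + count ahead? + ℓ            ≤⟨ +-monoˡ-≤ ℓ (count-disjoint (missed? (status s) e) ahead? idle? inj₁ inj₂
                                                                λ _ (sp , _) (fr , _) → contradiction (trans (≡.sym sp) fr) λ ()) ⟩
        count idle? + ℓ                                    ∎
        where
        split : ∀ v → Above e v → Seen (status s) e v ⊎ Ahead v
        split v ev with fresh? (status s v)
        ... | yes fr = inj₂ (fr , ev)
        ... | no ¬fr = inj₁ (¬fr , ev)

    st : Fin n → Status
    st = updateAt (status s) e (const spent)

    r : Fin ℓ → Route n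
    r = updateAt (routes s) q (const (route (body (routes s q)) e true))

    st-elim : (C : Fin n → Status → Set) → C e spent → (∀ v → v ≢ e → C v (status s v)) → ∀ v → C v (st v)
    st-elim C = updateAt-elim C (status s) e

    r-elim : (C : Fin ℓ → Route n → Set) → C q (route (body (routes s q)) e true) →
             (∀ p → p ≢ q → C p (routes s p)) → ∀ p → C p (r p)
    r-elim C = updateAt-elim C (routes s) q

    visited-mono : ∀ v → status s v ≢ fresh → st v ≢ fresh
    visited-mono = st-elim (λ v σ → status s v ≢ fresh → σ ≢ fresh) (λ _ ()) (λ _ _ → id)

    visited⁻ : ∀ v → st v ≢ fresh → status s v ≢ fresh
    visited⁻ = st-elim (λ v σ → σ ≢ fresh → status s v ≢ fresh)
      (λ _ eq → contradiction (trans (≡.sym e-live) eq) λ ()) (λ _ _ → id)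

    fresh⁻ : ∀ v → st v ≡ fresh → status s v ≡ fresh
    fresh⁻ = st-elim (λ v σ → σ ≡ fresh → status s v ≡ fresh) (λ ()) (λ _ _ → id)

    spent-mono : ∀ v → status s v ≡ spent → st v ≡ spent
    spent-mono = st-elim (λ v σ → status s v ≡ spent → σ ≡ spent) (λ _ → refl) (λ _ _ → id)

    nodes-mono : ∀ p {x} → x ∈ nodes (routes s p) → x ∈ nodes (r p)
    nodes-mono p {x} = r-elim (λ p ρ → x ∈ nodes (routes s p) → x ∈ nodes ρ) id (λ _ _ → id) p

    nodes⁻ : ∀ p {x} → x ∈ nodes (r p) → x ∈ nodes (routes s p)
    nodes⁻ p {x} = r-elim (λ p ρ → x ∈ nodes ρ → x ∈ nodes (routes s p)) id (λ _ _ → id) p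

    seen-≤ : ∀ x → #seen st x ≤ #seen (status s) x
    seen-≤ x = count-mono (seen? st x) (seen? (status s) x) λ {v} (v-seen , xv) → visited⁻ v v-seen , xv

    missed-mono : ∀ x → #missed (status s) x ≤ #missed st x
    missed-mono x = count-mono (missed? (status s) x) (missed? st x) (λ {v} (sp , rest) → spent-mono v sp , rest)

    -- If `e` is beyond x + k, the path was already `Out`. Otherwise `#out` may grow by one, and `e`
    -- pays: being stuck it is not adjacent to `x`, and if it lies below `x`, `near-end` puts it
    -- within `k`.
    fresh-bound′ : ∀ x → suc (toℕ x) < n → st x ≡ fresh → #seen st x + #out r x ≤ #missed st x
    fresh-bound′ x x<n x-fresh′ with toℕ x + k <? toℕ e
    ... | yes e-far = begin
      #seen st x + #out r x                   ≤⟨ +-mono-≤ (seen-≤ x) (count-mono (out? x ∘ r) (out? x ∘ routes s) λ {p} → out⁻ p) ⟩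
      #seen (status s) x + #out (routes s) x  ≤⟨ fresh-bound s x x<n (fresh⁻ x x-fresh′) ⟩
      #missed (status s) x                    ≤⟨ missed-mono x ⟩
      #missed st x                            ∎
      where
      open ≤-Reasoning
      out⁻ : ∀ p → Out x (r p) → Out x (routes s p)
      out⁻ = r-elim (λ p ρ → Out x ρ → Out x (routes s p)) (λ _ → inj₂ e-far) (λ _ _ → id)
    ... | no e-near = begin
      #seen st x + #out r x                         ≤⟨ +-mono-≤ (seen-≤ x) (count-mono-except (out? x ∘ r) (out? x ∘ routes s) q out⁻) ⟩
      #seen (status s) x + suc (#out (routes s) x)  ≡⟨ +-suc _ _ ⟩
      suc (#seen (status s) x + #out (routes s) x)  ≤⟨ s≤s (fresh-bound s x x<n x-fresh) ⟩
      suc (#missed (status s) x)                    ≤⟨ count-mono-< (missed? (status s) x) (missed? st x)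
                                                         (λ {v} (sp , rest) → spent-mono v sp , rest) e
                                                         (updateAt-updates e (status s) , window , x≁e)
                                                         (λ (sp , _) → contradiction (trans (≡.sym e-live) sp) λ ()) ⟩
      #missed st x                                  ∎
      where
      open ≤-Reasoning
      x-fresh : status s x ≡ fresh
      x-fresh = fresh⁻ x x-fresh′

      out⁻ : ∀ p → p ≢ q → Out x (r p) → Out x (routes s p)
      out⁻ = r-elim (λ p ρ → p ≢ q → Out x ρ → Out x (routes s p)) (λ q≢q → contradiction refl q≢q) (λ _ _ _ → id)

      x≁e : ¬ Adj G x e
      x≁e xe = stuck x (x-fresh , x<n , Graph.sym G xe)

      window : Window x e
      window with <-cmp (toℕ x) (toℕ e)
      ... | tri< x<e _ _ = inj₂ (x<e , s≤s (≮⇒≥ e-near))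
      ... | tri≈ _ eq _  = contradiction (trans (≡.sym e-live) (subst (λ v → status s v ≡ fresh) (toℕ-injective eq) x-fresh)) λ ()
      ... | tri> _ _ e<x = inj₁ (m≤n+o⇒m∸n≤o (toℕ x) k (s≤s⁻¹ (≤-trans (≤-trans (<⇒≤ x<n) near-end)
                             (s≤s (≤-reflexive (+-comm (toℕ e) k))))) , e<x)

    tip-bound′ : ∀ p → closed (r p) ≡ false →
                 suc (#seen st (tip (r p)) + #low r (tip (r p))) ≤ #missed st (tip (r p)) + ℓ
    tip-bound′ = r-elim (λ p ρ → closed ρ ≡ false → suc (#seen st (tip ρ) + #low r (tip ρ)) ≤ #missed st (tip ρ) + ℓ)
      (λ ()) λ p _ open-p → let x = tip (routes s p) in begin
        suc (#seen st x + #low r x)                   ≤⟨ s≤s (+-mono-≤ (seen-≤ x)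
                                                           (count-mono (low? x ∘ r) (low? x ∘ routes s) λ {p} → low⁻ p)) ⟩
        suc (#seen (status s) x + #low (routes s) x)  ≤⟨ tip-bound s p open-p ⟩
        #missed (status s) x + ℓ                      ≤⟨ +-monoˡ-≤ ℓ (missed-mono x) ⟩
        #missed st x + ℓ                              ∎
      where
      open ≤-Reasoning
      low⁻ : ∀ {x} p → Low x (r p) → Low x (routes s p)
      low⁻ {x} = r-elim (λ p ρ → Low x ρ → Low x (routes s p)) (λ { (() , _) }) (λ _ _ → id)

    -- Nothing lies above vₙ, so its window has at most `k` vertices and `full` makes them all
    -- neighbours; `near-end` places `e` among them.
    e~b : Adj G e b
    e~b = Graph.sym G (full (begin
      (toℕ b ⊓ k) + room b   ≡⟨ cong (λ m → (toℕ b ⊓ k) + (n ∸ m) ⊓ k) b-last ⟩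
      (toℕ b ⊓ k) + (n ∸ n) ⊓ k ≡⟨ cong (λ m → (toℕ b ⊓ k) + m ⊓ k) (n∸n≡0 n) ⟩
      (toℕ b ⊓ k) + 0        ≡⟨ +-identityʳ _ ⟩
      toℕ b ⊓ k              ≤⟨ m⊓n≤n (toℕ b) k ⟩
      k                      ∎)
      (inj₁ (m≤n+o⇒m∸n≤o (toℕ b) k (s≤s⁻¹ (≤-trans (≤-reflexive b-last)
               (≤-trans near-end (s≤s (≤-reflexive (+-comm (toℕ e) k)))))) ,
             s≤s⁻¹ (≤-trans (proj₂ (inner s q (tip∈nodes (routes s q)))) (≤-reflexive (≡.sym b-last))))))
      where open ≤-Reasoning

    close : State
    close = record
      { status   = st
      ; routes   = r
      ; root-seen = visited-mono a (root-seen s)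
      ; linked   = r-elim (λ _ ρ → Linked (Adj G) (a ∷ nodes ρ)) (linked s q) (λ p _ → linked s p)
      ; unique   = r-elim (λ _ ρ → Unique (nodes ρ)) (unique s q) (λ p _ → unique s p)
      ; inner    = λ p x∈ → inner s p (nodes⁻ p x∈)
      ; visited  = λ p x∈ → visited-mono _ (visited s p (nodes⁻ p x∈))
      ; disjoint = λ p p′ x∈p x∈p′ → disjoint s p p′ (nodes⁻ p x∈p) (nodes⁻ p′ x∈p′)
      ; covered  = λ x x-seen → [ inj₁ , (λ (p , x∈) → inj₂ (p , nodes-mono p x∈)) ]′ (covered s x (visited⁻ x x-seen))
      ; tip-live = r-elim (λ _ ρ → closed ρ ≡ false → st (tip ρ) ≡ live) (λ ())
                     (λ p p≢q open-p → trans (updateAt-minimal _ e (status s) (tip-distinct s p≢q)) (tip-live s p open-p))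
      ; tip-last = r-elim (λ _ ρ → closed ρ ≡ true → Adj G (tip ρ) b) (λ _ → e~b) (λ p _ → tip-last s p)
      ; fresh-bound = fresh-bound′
      ; tip-bound   = tip-bound′
      }

  -- Termination of the greedy process

  AllClosed : State → Set
  AllClosed s = ∀ p → closed (routes s p) ≡ true

  step : ∀ s → AllClosed s ⊎ ∃ λ s′ → size s′ < size s
  step s with argmin (λ p → closed (routes s p) Bool.≟ false) (toℕ ∘ tip ∘ routes s)
  ... | inj₁ none = inj₁ λ p → Bool.¬-not (none p)
  ... | inj₂ (q , lowest) with argmin (next? s q) toℕ
  ... | inj₁ stuck = inj₂ (close , +-mono-≤-<
          (count-mono (fresh? ∘ st) (fresh? ∘ status s) λ {v} → fresh⁻ v)
          (count-mono-< (λ p → closed (r p) Bool.≟ false) (λ p → closed (routes s p) Bool.≟ false)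
            (λ {p} → r-elim (λ p ρ → closed ρ ≡ false → closed (routes s p) ≡ false) (λ ()) (λ _ _ → id) p)
            q (proj₁ lowest)
            (subst (λ ρ → closed ρ ≢ false) (≡.sym (updateAt-updates q (routes s))) λ ())))
    where open Close s q lowest stuck
  ... | inj₂ (y , next , least) = inj₂ (extend , +-mono-<-≤
          (count-mono-< (fresh? ∘ st) (fresh? ∘ status s) (λ {v} → proj₁ ∘ fresh⁻ v) y (proj₁ next)
            (λ eq → proj₂ (fresh⁻ y eq) refl))
          (count-mono (λ p → closed (r p) Bool.≟ false) (λ p → closed (routes s p) Bool.≟ false)
            (λ {p} → r-elim (λ p ρ → closed ρ ≡ false → closed (routes s p) ≡ false) (λ _ → proj₁ lowest) (λ _ _ → id) p)))
    where open Extend s q lowest y next least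

  run : ∀ m s → size s ≤ m → ∃ AllClosed
  run m s size≤m with step s
  ... | inj₁ done = s , done
  run zero    s size≤m | inj₂ (s′ , s′<s) = contradiction (≤-trans s′<s size≤m) λ ()
  run (suc m) s size≤m | inj₂ (s′ , s′<s) = run m s′ (s≤s⁻¹ (≤-trans s′<s size≤m))

  -- Spanning: no vertex is left once all paths are closed

  module Finished (s : State) (done : AllClosed s) where

    -- Downward induction on `x`, with `d` bounding the distance to the end, so every vertex above
    -- `x` except vₙ is already seen. All paths being `Out`, an unvisited `x` has #missed ≥ #seen +
    -- ℓ ≥ 1, and `slack` then gives ℓ + #missed ≤ room ≤ #seen + 1, impossible for ℓ ≥ 1.
    all-seen : ∀ d x → n ≤ toℕ x + d → suc (toℕ x) < n → status s x ≢ fresh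
    all-seen zero x n≤x _ _ = <⇒≱ (toℕ<n x) (≤-trans n≤x (≤-reflexive (+-identityʳ (toℕ x))))
    all-seen (suc d) x n≤x+d x<n x-fresh =
      [ (λ none → contradiction (≤-trans 1≤ℓ (≤-trans (m≤n+m ℓ (#seen (status s) x)) (≤-trans bound (≤-reflexive none)))) λ ())
      , (λ some → m+1+n≰m (suc (#seen (status s) x)) (begin
          suc (#seen (status s) x) + 1         ≤⟨ +-monoʳ-≤ 1 (+-monoʳ-≤ (#seen (status s) x) 1≤ℓ) ⟩
          1 + (#seen (status s) x + ℓ)         ≤⟨ +-mono-≤ 1≤ℓ bound ⟩
          ℓ + #missed (status s) x             ≤⟨ some ⟩
          room x                               ≡⟨ count-above x ⟨
          count (above? x)                     ≤⟨ count-mono-except (above? x) (seen? (status s) x) b above-seen ⟩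
          suc (#seen (status s) x)             ∎))
      ]′ (slack x (missed? (status s) x) (proj₁ ∘ proj₂) (λ _ → proj₂ ∘ proj₂))
      where
      open ≤-Reasoning
      bound : #seen (status s) x + ℓ ≤ #missed (status s) x
      bound = subst (λ c → #seen (status s) x + c ≤ #missed (status s) x)
                (count-full (out? x ∘ routes s) (inj₁ ∘ done)) (fresh-bound s x x<n x-fresh)

      above-seen : ∀ v → v ≢ b → Above x v → Seen (status s) x v
      above-seen v v≢b xv@(x<v , _) =
        all-seen d v (≤-trans n≤x+d (≤-trans (≤-reflexive (+-suc (toℕ x) d)) (+-monoˡ-≤ d x<v)))
          (≤∧≢⇒< (toℕ<n v) λ eq → v≢b (toℕ-injective (suc-injective (trans eq (≡.sym b-last))))) , xv

    interior : Fin ℓ → List (Fin n)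
    interior p = nodes (routes s p)

    ∉-root : ∀ p {x} → x ∈ interior p → a ≢ x
    ∉-root p x∈ refl = <-irrefl (≡.sym a-first) (proj₁ (inner s p x∈))

    ∉-end : ∀ p {x} → x ∈ interior p → x ≢ b
    ∉-end p x∈ refl = <-irrefl b-last (proj₂ (inner s p x∈))

    subdivision : a ≢ b → SpanningK2Subdivision G ℓ a b
    subdivision a≢b = interior , is-path , nonempty , (λ p q p≢q x x∈p x∈q → p≢q (disjoint s p q x∈p x∈q)) , spanning
      where
      is-path : ∀ p → IsPath G a b (interior p)
      is-path p =
          linked-snoc (a ∷ body (routes s p)) (linked s p) (tip-last s p (done p))
        , All.tabulate (λ x∈ → [ ∉-root p , (λ { (here refl) → a≢b }) ]′ (∈-++⁻ (interior p) x∈))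
          ∷ Unique.++⁺ (unique s p) (All.[] ∷ []) λ { (x∈ , here x≡b) → ∉-end p x∈ x≡b }

      nonempty : ∀ p → interior p ≢ []
      nonempty p eq with subst (tip (routes s p) ∈_) eq (tip∈nodes (routes s p))
      ... | ()

      spanning : ∀ x → x ≡ a ⊎ x ≡ b ⊎ ∃ λ p → x ∈ interior p
      spanning x with x ≟ b
      ... | yes x≡b = inj₂ (inj₁ x≡b)
      ... | no  x≢b with covered s x (all-seen n x (m≤n+m n (toℕ x))
                          (≤∧≢⇒< (toℕ<n x) λ eq → x≢b (toℕ-injective (suc-injective (trans eq (≡.sym b-last))))))
      ... | inj₁ x≡a = inj₁ x≡a
      ... | inj₂ x∈  = inj₂ (inj₂ x∈)

  -- The initial state: ℓ paths of one edge leaving v₁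

  module Initial (ℓ+2≤n : ℓ + 2 ≤ n) where

    status₀ : ℕ → Status
    status₀ zero = spent
    status₀ (suc i) with i <? ℓ
    ... | yes _ = live
    ... | no  _ = fresh

    status₀-live : ∀ {i} → i < ℓ → status₀ (suc i) ≡ live
    status₀-live {i} i<ℓ with i <? ℓ
    ... | yes _  = refl
    ... | no i≮ℓ = contradiction i<ℓ i≮ℓ

    status₀-fresh : ∀ i → status₀ i ≡ fresh → ℓ < i
    status₀-fresh (suc i) eq with i <? ℓ
    ... | no i≮ℓ = s≤s (≮⇒≥ i≮ℓ)

    status₀-seen : ∀ i → status₀ i ≢ fresh → i ≤ ℓ
    status₀-seen zero _ = z≤n
    status₀-seen (suc i) ¬fr with i <? ℓ
    ... | yes i<ℓ = i<ℓ
    ... | no _    = contradiction refl ¬fr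

    -- By n ≥ ℓ + 2 the starting tips v₂, ..., v_{ℓ+1} all lie strictly before vₙ.
    entry-bound : (p : Fin ℓ) → suc (suc (toℕ p)) < n
    entry-bound p = ≤-trans (s≤s (s≤s (toℕ<n p))) (≤-trans (≤-reflexive (+-comm 2 ℓ)) ℓ+2≤n)

    entry : Fin ℓ → Fin n
    entry p = fromℕ< (<⇒≤ (entry-bound p))

    toℕ-entry : ∀ p → toℕ (entry p) ≡ suc (toℕ p)
    toℕ-entry p = toℕ-fromℕ< (<⇒≤ (entry-bound p))

    st : Fin n → Status
    st = status₀ ∘ toℕ

    r : Fin ℓ → Route n
    r p = route [] (entry p) false

    entry-live : ∀ p → st (entry p) ≡ live
    entry-live p = trans (cong status₀ (toℕ-entry p)) (status₀-live (toℕ<n p))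

    initial : State
    initial = record
      { status = st
      ; routes = r
      ; root-seen = λ eq → contradiction (trans (≡.sym (cong status₀ a-first)) eq) λ ()
      -- The window of v₁ contains all entries because ℓ ≤ k, and `full` makes them neighbours.
      ; linked = λ p → full root-small (inj₂ (root-above p)) ∷ [-]
      ; unique = λ p → All.[] ∷ []
      ; inner = λ { p (here refl) → subst (λ i → 0 < i × suc i < n) (≡.sym (toℕ-entry p)) (s≤s z≤n , entry-bound p) }
      ; visited = λ { p (here refl) eq → contradiction (trans (≡.sym (entry-live p)) eq) λ () }
      ; disjoint = λ { p q (here refl) (here eq) →
          toℕ-injective (suc-injective (trans (≡.sym (toℕ-entry p)) (trans (cong toℕ eq) (toℕ-entry q)))) }
      ; covered = covered₀
      ; tip-live = λ p _ → entry-live p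
      ; tip-last = λ p ()
      -- An unvisited vertex lies above every visited one, so both counts on the left are empty.
      ; fresh-bound = λ x _ x-fresh → ≤-trans (≤-reflexive (cong₂ _+_
          (count-empty (seen? st x) λ v (v-seen , x<v , _) →
            <-asym x<v (≤-<-trans (status₀-seen (toℕ v) v-seen) (status₀-fresh (toℕ x) x-fresh)))
          (count-empty (out? x ∘ r) λ { p (inj₁ ()) ; p (inj₂ far) →
            <⇒≱ (status₀-fresh (toℕ x) x-fresh) (≤-trans (m≤m+n (toℕ x) k)
              (<⇒≤ (<-≤-trans far (≤-trans (≤-reflexive (toℕ-entry p)) (toℕ<n p))))) }))) z≤n
      ; tip-bound = λ p _ → ≤-trans (tip-bound₀ p) (m≤n+m ℓ _)
      }
      where
      open ≤-Reasoning
      root-small : (toℕ a ⊓ k) + room a ≤ k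
      root-small = ≤-trans (+-monoˡ-≤ (room a) (≤-trans (m⊓n≤m (toℕ a) k) (≤-reflexive a-first))) (m⊓n≤n _ k)

      root-above : ∀ p → Above a (entry p)
      root-above p = subst₂ (λ i j → i < j × j < suc (i + k)) (≡.sym a-first) (≡.sym (toℕ-entry p))
                       (s≤s z≤n , s≤s (≤-trans (toℕ<n p) ℓ≤k))

      covered₀ : ∀ x → st x ≢ fresh → x ≡ a ⊎ ∃ λ p → x ∈ nodes (r p)
      covered₀ x ¬fr = go (toℕ x) refl
        where
        go : ∀ i → toℕ x ≡ i → x ≡ a ⊎ ∃ λ p → x ∈ nodes (r p)
        go zero    eq = inj₁ (toℕ-injective (trans eq (≡.sym a-first)))
        go (suc i) eq = inj₂ (fromℕ< i<ℓ , here (toℕ-injective (trans eq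
                          (≡.sym (trans (toℕ-entry (fromℕ< i<ℓ)) (cong suc (toℕ-fromℕ< i<ℓ)))))))
          where
          i<ℓ : i < ℓ
          i<ℓ = ≤-trans (≤-reflexive (≡.sym eq)) (status₀-seen (toℕ x) ¬fr)

      -- With i = `toℕ p`, visited vertices above `entry p` sit at positions i + 2 to ℓ, and only
      -- tips of index below i are low: (ℓ - i - 1) + i + 1 = ℓ.
      tip-bound₀ : ∀ p → suc (#seen st (entry p) + #low r (entry p)) ≤ ℓ
      tip-bound₀ p = begin
        suc (#seen st x + #low r x)            ≤⟨ s≤s (+-mono-≤
          (count-mono (seen? st x) (between? (2 + i) (suc ℓ)) λ {v} (v-seen , x<v , _) →
            ≤-trans (≤-reflexive (cong suc (≡.sym (toℕ-entry p)))) x<v , s≤s (status₀-seen (toℕ v) v-seen))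
          (count-mono (low? x ∘ r) (between? 0 i) λ {q} (_ , q<p) →
            z≤n , s≤s⁻¹ (subst₂ _<_ (toℕ-entry q) (toℕ-entry p) q<p))) ⟩
        suc (count {n} (between? (2 + i) (suc ℓ)) + count {ℓ} (between? 0 i))
                                               ≡⟨ cong suc (cong₂ _+_ (count-between n (2 + i) (suc ℓ)) (count-between ℓ 0 i)) ⟩
        suc ((suc ℓ ⊓ n) ∸ (2 + i) + (i ⊓ ℓ))  ≤⟨ s≤s (+-mono-≤ (∸-monoˡ-≤ (2 + i) (m⊓n≤m (suc ℓ) n)) (m⊓n≤m i ℓ)) ⟩
        suc (ℓ ∸ suc i + i)                    ≡⟨ +-suc (ℓ ∸ suc i) i ⟨
        ℓ ∸ suc i + suc i                      ≡⟨ m∸n+n≡m (toℕ<n p) ⟩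
        ℓ                                      ∎
        where
        x = entry p
        i = toℕ p

theorem3 : (n k ℓ : ℕ) → ℓ ≤ k → 1 ≤ ℓ → ℓ + 2 ≤ n → (0<n : 0 < n) →
    (G : Graph n) → BandwidthLabelling G k → DegreeCondition G k ℓ →
    SpanningK2Subdivision G ℓ (vFirst 0<n) (vLast 0<n)
theorem3 n k ℓ ℓ≤k 1≤ℓ ℓ+2≤n 0<n@(s≤s _) G bandwidth degrees = subdivision first≢last
  where
  first-index : toℕ (vFirst 0<n) ≡ 0
  first-index = toℕ-fromℕ< 0<n

  -- Matching `0<n` against `s≤s` makes `n` a successor, so the index `n ∸ 1` reduces.
  last-index : suc (toℕ (vLast 0<n)) ≡ n
  last-index = cong suc (toℕ-fromℕ< _)

  first≢last : vFirst 0<n ≢ vLast 0<n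
  first≢last eq = contradiction
    (≤-trans (≤-trans (m≤n+m 2 ℓ) ℓ+2≤n) (≤-reflexive (trans (≡.sym last-index) (cong suc (trans (cong toℕ (≡.sym eq)) first-index)))))
    λ { (s≤s ()) }

  open Greedy G k ℓ ℓ≤k 1≤ℓ bandwidth degrees (vFirst 0<n) (vLast 0<n) first-index last-index

  final : ∃ AllClosed
  final = run _ (Initial.initial ℓ+2≤n) ≤-refl

  open Finished (proj₁ final) (proj₂ final)
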